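{- The following triple $(\Phi,\alpha,\beta)$ is an institution morphism from $\mathcal{I}_{mts}$ to $\mathcal{I}_{cc}$: - $\Phi:\mathbf{Sign}_{mts}\to\mathbf{Sign}_{cc}$ maps a set $A$ to the triple $(\mathrm{cv}(A),\mathrm{ct}(A),\emptyset)$, where $\mathrm{cv}(A)=\{\mathrm{cv}(a)\mid a\in A\}$ and $\mathrm{ct}(A)=\{\mathrm{ct}(a)\mid a\in A\}$ are two disjoint copies of $A$; for $f:A\to B$, $\Phi(f)(\mathrm{cv}(a))=\mathrm{cv}(f(a))$ and $\Phi(f)(\mathrm{ct}(a))=\mathrm{ct}(f(a))$. - $\alpha:\mathit{sen}_{cc}\circ\Phi\Rightarrow\mathit{sen}_{mts}$ translates a formula in $\mathit{sen}_{cc}(\mathrm{cv}(A),\mathrm{ct}(A),\emptyset)$ by $\alpha(\top)=\top$, $\alpha(\bot)=\bot$, $\alpha(\varphi_1\wedge\varphi_2)=\alpha(\varphi_1)\wedge\alpha(\varphi_2)$, $\alpha(\varphi_1\vee\varphi_2)=\alpha(\varphi_1)\vee\alpha(\varphi_2)$, $\alpha(\langle\mathrm{cv}(a)\rangle\varphi)=\langle a\rangle\alpha(\varphi)$, $\alpha([\mathrm{ct}(a)]\varphi)=[a]\alpha(\varphi)$. - $\beta:\mathbf{Mod}_{mts}\Rightarrow\mathbf{Mod}_{cc}\circ\Phi$ maps an MTS $(M,s)$ in $\mathbf{Mod}_{mts}(A)$ to $(\mathcal{C}(M),s)$ and a morphism $R$ to itself.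
   Context: An institution is a quadruple $(\mathbf{Sign},\mathit{sen},\mathbf{Mod},\models)$ with $\mathbf{Sign}$ a category (of signatures), functors $\mathit{sen}:\mathbf{Sign}\to\mathbf{Set}$ and $\mathbf{Mod}:\mathbf{Sign}^{op}\to\mathbf{Cat}$, and relations $\models_\Sigma\subseteq|\mathbf{Mod}(\Sigma)|\times\mathit{sen}(\Sigma)$ such that for all $H:\Sigma\to\Sigma'$, $M'\in|\mathbf{Mod}(\Sigma')|$, $\varphi\in\mathit{sen}(\Sigma)$: $M'\models_{\Sigma'}\mathit{sen}(H)(\varphi)\iff\mathbf{Mod}(H)(M')\models_\Sigma\varphi$. An institution morphism from $(\mathbf{Sign},\mathit{sen},\mathbf{Mod},\models)$ to $(\mathbf{Sign}',\mathit{sen}',\mathbf{Mod}',\models')$ consists of a functor $\Phi:\mathbf{Sign}\to\mathbf{Sign}'$, a natural transformation $\beta:\mathbf{Mod}\Rightarrow\mathbf{Mod}'\circ\Phi$ and a natural transformation $\alpha:\mathit{sen}'\circ\Phi\Rightarrow\mathit{sen}$ such that $M\models_\Sigma\alpha_\Sigma(H)\iff\beta_\Sigma(M)\models'_{\Phi(\Sigma)}H$ for all $\Sigma\in|\mathbf{Sign}|$, $M\in|\mathbf{Mod}(\Sigma)|$, $H\in\mathit{sen}'(\Phi(\Sigma))$. LTSs and MTSs. A labelled transition system (LTS) over a set of actions is a set of states with a labelled transition relation $\to$. A modal transition system (MTS) over $A$ is a set of states $P$ with $\to_\Box\subseteq\to_\Diamond\subseteq P\times A\times P$. A refinement between MTSs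 is a relation $R$ such that $p\,R\,q$ implies: if $p\xrightarrow{a}_\Box p'$ then some $q\xrightarrow{a}_\Box q'$ with $p'\,R\,q'$; if $q\xrightarrow{a}_\Diamond q'$ then some $p\xrightarrow{a}_\Diamond p'$ with $p'\,R\,q'$. For pairwise disjoint sets $A,B,C$ (covariant, contravariant, bivariant actions), a covariant-contravariant simulation between LTSs over $A\cup B\cup C$ is a relation $R$ such that $p\,R\,q$ implies: for $a\in A\cup C$, if $p\xrightarrow{a}p'$ then some $q\xrightarrow{a}q'$ with $p'\,R\,q'$; for $a\in B\cup C$, if $q\xrightarrow{a}q'$ then some $p\xrightarrow{a}p'$ with $p'\,R\,q'$. $\mathcal{I}_{cc}$: objects of $\mathbf{Sign}_{cc}$ are triples $(A,B,C)$ of pairwise disjoint sets, morphisms are functions $f:A\cup B\cup C\to A'\cup B'\cup C'$ with $f(A)\subseteq A'$, $f(B)\subseteq B'$, $f(C)\subseteq C'$. $\mathit{sen}_{cc}(A,B,C)$ is the set of formulae $\varphi::=\bot\mid\top\mid\varphi\wedge\varphi\mid\varphi\vee\varphi\mid[b]\varphi\mid\langle a\rangle\varphi$ ($a\in A\cup C$, $b\in B\cup C$); $\mathit{sen}_{cc}(f)$ replaces each action $a$ by $f(a)$. $\mathbf{Mod}_{cc}(A,B,C)$ has as objects LTSs over $A\cup B\cup C$ with a distinguished state, $(P,p)$, and as morphisms $(P,p)\to(Q,q)$ the covariant-contravariant simulations $R$ with $(p,q)\in R$ (composition is relational composition). $\mathbf{Mod}_{cc}(f)$ maps $(P,p)$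 to $(P|_f,p)$ with the same states and $s\xrightarrow{a}s'$ in $P|_f$ iff $s\xrightarrow{f(a)}s'$ in $P$, and maps each $R$ to itself. Satisfaction: Boolean cases as usual; $(P,s)\models[b]\varphi$ iff $(P,s')\models\varphi$ for all $s\xrightarrow{b}s'$; $(P,s)\models\langle a\rangle\varphi$ iff $(P,s')\models\varphi$ for some $s\xrightarrow{a}s'$. $\mathcal{I}_{mts}$: $\mathbf{Sign}_{mts}$ is the category of sets. $\mathit{sen}_{mts}(A)$ is the set of formulae $\varphi::=\bot\mid\top\mid\varphi\wedge\varphi\mid\varphi\vee\varphi\mid[a]\varphi\mid\langle a\rangle\varphi$ ($a\in A$); $\mathit{sen}_{mts}(f)$ replaces each $a$ by $f(a)$. $\mathbf{Mod}_{mts}(A)$ has as objects MTSs over $A$ with a distinguished state, $(M,m)$, and as morphisms $(M,m)\to(N,n)$ the refinements $R$ with $(m,n)\in R$. $\mathbf{Mod}_{mts}(f)$ maps $(M,m)$ to $(M|_f,m)$ with the same states and $p\xrightarrow{a}_\Diamond p'$ (resp. $\xrightarrow{a}_\Box$) in $M|_f$ iff $p\xrightarrow{f(a)}_\Diamond p'$ (resp. $\xrightarrow{f(a)}_\Box$) in $M$, and maps each $R$ to itself. Satisfaction: Boolean cases as usual; $(M,s)\models[a]\varphi$ iff $(M,s')\models\varphi$ for all $s\xrightarrow{a}_\Diamond s'$; $(M,s)\models\langle a\rangle\varphi$ iff $(M,s')\models\varphi$ for some $s\xrightarrow{a}_\Box s'$. For an MTS $M$ over $A$, $\mathcal{C}(M)$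 is the LTS with the same states, covariant actions $\mathrm{cv}(A)$, contravariant actions $\mathrm{ct}(A)$, no bivariant actions, and exactly the transitions $p\xrightarrow{\mathrm{ct}(a)}p'$ for each $p\xrightarrow{a}_\Diamond p'$ and $p\xrightarrow{\mathrm{cv}(a)}p'$ for each $p\xrightarrow{a}_\Box p'$ in $M$. -}

module Defs where

open import Data.Empty using (⊥; ⊥-elim-irr)
open import Data.Product using (_×_; _,_; proj₁; proj₂; ∃-syntax; map₂)
import Data.Product as Product
open import Data.Sum using (_⊎_; inj₁; inj₂)
import Data.Sum as Sum
open import Data.Unit using (⊤; tt)
open import Function.Base using (_∘′_; id)
open import Function.Bundles using (_⇔_; mk⇔; Equivalence)
open import Level using (Level; _⊔_; 0ℓ) renaming (suc to lsuc)
open import Relation.Binary.Core using (Rel; REL; _⇒_)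
open import Relation.Binary.Construct.Composition using (_;_)
open import Relation.Binary.PropositionalEquality
  using (_≡_; _≗_; refl; sym; trans; cong; cong₂; subst₂; isEquivalence)
open import Relation.Binary.Structures using (IsEquivalence)
open import Relation.Nullary using (¬_)
open import Relation.Unary using (Pred; _∈_; _∪_)

private
  variable
    o ℓ e o′ ℓ′ e′ o″ ℓ″ e″ : Level

------------------------------------------------------------------------
-- Categories and functors

record Category (o ℓ e : Level) : Set (lsuc (o ⊔ ℓ ⊔ e)) where
  infix  4 _≈_
  infixr 9 _∘_
  field
    Obj       : Set o
    Hom       : Obj → Obj → Set ℓ
    _≈_       : ∀ {X Y} → Rel (Hom X Y) e
    idn       : ∀ {X} → Hom X X
    _∘_       : ∀ {X Y Z} → Hom Y Z → Hom X Y → Hom X Z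
    equiv     : ∀ {X Y} → IsEquivalence (_≈_ {X} {Y})
    ∘-resp-≈  : ∀ {X Y Z} {g i : Hom Y Z} {f h : Hom X Y} →
                g ≈ i → f ≈ h → g ∘ f ≈ i ∘ h
    identityˡ : ∀ {X Y} (f : Hom X Y) → idn ∘ f ≈ f
    identityʳ : ∀ {X Y} (f : Hom X Y) → f ∘ idn ≈ f
    assoc     : ∀ {X Y Z W} (h : Hom Z W) (g : Hom Y Z) (f : Hom X Y) →
                (h ∘ g) ∘ f ≈ h ∘ (g ∘ f)

op : Category o ℓ e → Category o ℓ e
op C = record
  { Obj = C.Obj ; Hom = λ X Y → C.Hom Y X ; _≈_ = C._≈_
  ; idn = C.idn ; _∘_ = λ g f → f C.∘ g
  ; equiv = C.equiv
  ; ∘-resp-≈ = λ p q → C.∘-resp-≈ q p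
  ; identityˡ = C.identityʳ ; identityʳ = C.identityˡ
  ; assoc = λ h g f → IsEquivalence.sym C.equiv (C.assoc f g h)
  }
  where module C = Category C

module _ (C : Category o ℓ e) (D : Category o′ ℓ′ e′) where
  private
    module C = Category C
    module D = Category D

  record IsFunctor (F₀ : C.Obj → D.Obj)
                   (F₁ : ∀ {X Y} → C.Hom X Y → D.Hom (F₀ X) (F₀ Y)) :
                   Set (o ⊔ ℓ ⊔ e ⊔ e′) where
    field
      F-resp-≈     : ∀ {X Y} {f g : C.Hom X Y} → f C.≈ g → F₁ f D.≈ F₁ g
      identity     : ∀ {X} → F₁ (C.idn {X}) D.≈ D.idn
      homomorphism : ∀ {X Y Z} (g : C.Hom Y Z) (f : C.Hom X Y) →
                     F₁ (g C.∘ f) D.≈ F₁ g D.∘ F₁ f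

  record Functor : Set (o ⊔ ℓ ⊔ e ⊔ o′ ⊔ ℓ′ ⊔ e′) where
    constructor functor
    field
      {F₀}      : C.Obj → D.Obj
      {F₁}      : ∀ {X Y} → C.Hom X Y → D.Hom (F₀ X) (F₀ Y)
      isFunctor : IsFunctor F₀ F₁
    open IsFunctor isFunctor public

opF : {C : Category o ℓ e} {D : Category o′ ℓ′ e′} →
      Functor C D → Functor (op C) (op D)
opF F = functor {F₀ = F.F₀} {F₁ = F.F₁} (record
  { F-resp-≈ = F.F-resp-≈
  ; identity = F.identity
  ; homomorphism = λ g f → F.homomorphism f g
  })
  where module F = Functor F

idF : {C : Category o ℓ e} → Functor C C
idF {C = C} = functor {F₀ = λ X → X} {F₁ = λ f → f} (record
  { F-resp-≈ = λ p → p
  ; identity = IsEquivalence.refl C.equiv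
  ; homomorphism = λ _ _ → IsEquivalence.refl C.equiv
  })
  where module C = Category C

infixr 9 _∘F_

_∘F_ : {B : Category o ℓ e} {C : Category o′ ℓ′ e′} {D : Category o″ ℓ″ e″} →
       Functor C D → Functor B C → Functor B D
_∘F_ {D = D} G F =
  functor {F₀ = λ X → G.F₀ (F.F₀ X)} {F₁ = λ f → G.F₁ (F.F₁ f)} (record
  { F-resp-≈ = λ p → G.F-resp-≈ (F.F-resp-≈ p)
  ; identity = D.trans (G.F-resp-≈ F.identity) G.identity
  ; homomorphism = λ g f →
      D.trans (G.F-resp-≈ (F.homomorphism g f)) (G.homomorphism _ _)
  })
  where
  module F = Functor F
  module G = Functor G
  module D {X} {Y} = IsEquivalence (Category.equiv D {X} {Y})

module _ {C : Category o ℓ e} {D : Category o′ ℓ′ e′} where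
  private
    module C = Category C
    module D = Category D

  IsNatural : (F G : Functor C D) →
              (∀ X → D.Hom (Functor.F₀ F X) (Functor.F₀ G X)) →
              Set (o ⊔ ℓ ⊔ e′)
  IsNatural F G η =
    ∀ {X Y} (f : C.Hom X Y) →
    (η Y D.∘ Functor.F₁ F f) D.≈ (Functor.F₁ G f D.∘ η X)

  -- Strict equality of functors: equal (not merely isomorphic) on objects.
  record _≡F_ (F G : Functor C D) : Set (o ⊔ ℓ ⊔ o′ ⊔ e′) where
    private
      module F = Functor F
      module G = Functor G
    field
      eq₀ : ∀ X → F.F₀ X ≡ G.F₀ X
      eq₁ : ∀ {X Y} (f : C.Hom X Y) →
            subst₂ D.Hom (eq₀ X) (eq₀ Y) (F.F₁ f) D.≈ G.F₁ f

module _ (D : Category o ℓ e) where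
  open Category D
  private
    module E {X} {Y} = IsEquivalence (equiv {X} {Y})

  subst₂-sym : ∀ {X X′ Y Y′} (p : X ≡ X′) (q : Y ≡ Y′) {f : Hom X Y} {g} →
               subst₂ Hom p q f ≈ g → subst₂ Hom (sym p) (sym q) g ≈ f
  subst₂-sym refl refl f≈g = E.sym f≈g

  subst₂-trans : ∀ {X X′ X″ Y Y′ Y″}
                 (p : X ≡ X′) (p′ : X′ ≡ X″) (q : Y ≡ Y′) (q′ : Y′ ≡ Y″)
                 {f : Hom X Y} {g h} →
                 subst₂ Hom p q f ≈ g → subst₂ Hom p′ q′ g ≈ h →
                 subst₂ Hom (trans p p′) (trans q q′) f ≈ h
  subst₂-trans refl refl refl refl f≈g g≈h = E.trans f≈g g≈h

subst₂-F : {C : Category o ℓ e} {D : Category o′ ℓ′ e′} (F : Functor C D) →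
           let open Functor F in
           ∀ {X X′ Y Y′} (p : X ≡ X′) (q : Y ≡ Y′)
           {f : Category.Hom C X Y} {g} →
           Category._≈_ C (subst₂ (Category.Hom C) p q f) g →
           Category._≈_ D
             (subst₂ (Category.Hom D) (cong F₀ p) (cong F₀ q) (F₁ f)) (F₁ g)
subst₂-F F refl refl = Functor.F-resp-≈ F

Sets : ∀ ℓ → Category (lsuc ℓ) ℓ ℓ
Sets ℓ = record
  { Obj = Set ℓ ; Hom = λ X Y → X → Y ; _≈_ = _≗_
  ; idn = id ; _∘_ = _∘′_
  ; equiv = record
    { refl = λ _ → refl
    ; sym = λ p x → sym (p x)
    ; trans = λ p q x → trans (p x) (q x)
    }
  ; ∘-resp-≈ = λ {_} {_} {_} {g} p q x → trans (cong g (q x)) (p _)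
  ; identityˡ = λ _ _ → refl
  ; identityʳ = λ _ _ → refl
  ; assoc = λ _ _ _ _ → refl
  }

Cat : ∀ o ℓ e → Category (lsuc (o ⊔ ℓ ⊔ e)) (o ⊔ ℓ ⊔ e) (o ⊔ ℓ ⊔ e)
Cat o ℓ e = record
  { Obj = Category o ℓ e ; Hom = Functor ; _≈_ = λ F G → F ≡F G
  ; idn = idF ; _∘_ = _∘F_
  ; equiv = λ {_} {D} → record
    { refl = record
      { eq₀ = λ _ → refl
      ; eq₁ = λ _ → IsEquivalence.refl (Category.equiv D)
      }
    ; sym = λ p → record
      { eq₀ = λ X → sym (eq₀ p X)
      ; eq₁ = λ f → subst₂-sym D (eq₀ p _) (eq₀ p _) (eq₁ p f)
      }
    ; trans = λ p q → record
      { eq₀ = λ X → trans (eq₀ p X) (eq₀ q X)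
      ; eq₁ = λ f → subst₂-trans D (eq₀ p _) (eq₀ q _) (eq₀ p _) (eq₀ q _)
                                   (eq₁ p f) (eq₁ q f)
      }
    }
  ; ∘-resp-≈ = λ {_} {_} {D} {G} {I} {F} {H} p q → record
    { eq₀ = λ X → trans (cong (F₀ G) (eq₀ q X)) (eq₀ p (F₀ H X))
    ; eq₁ = λ f → subst₂-trans D (cong (F₀ G) (eq₀ q _)) (eq₀ p _)
                                 (cong (F₀ G) (eq₀ q _)) (eq₀ p _)
                    (subst₂-F G (eq₀ q _) (eq₀ q _) (eq₁ q f))
                    (eq₁ p (F₁ H f))
    }
  ; identityˡ = λ {_} {D} _ → record
    { eq₀ = λ _ → refl ; eq₁ = λ _ → IsEquivalence.refl (Category.equiv D) }
  ; identityʳ = λ {_} {D} _ → record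
    { eq₀ = λ _ → refl ; eq₁ = λ _ → IsEquivalence.refl (Category.equiv D) }
  ; assoc = λ {_} {_} {_} {D} _ _ _ → record
    { eq₀ = λ _ → refl ; eq₁ = λ _ → IsEquivalence.refl (Category.equiv D) }
  }
  where
  open _≡F_
  open Functor

------------------------------------------------------------------------
-- Institutions

record Institution (o ℓ e s mo mℓ me r : Level) :
                   Set (lsuc (o ⊔ ℓ ⊔ e ⊔ s ⊔ mo ⊔ mℓ ⊔ me ⊔ r)) where
  field
    Sign : Category o ℓ e
    sen  : Functor Sign (Sets s)
    Mod  : Functor (op Sign) (Cat mo mℓ me)

  open Category Sign public using () renaming (Obj to Signature; Hom to SigMor)

  Sen : Signature → Set s
  Sen = Functor.F₀ sen

  sen₁ : ∀ {S S′} → SigMor S S′ → Sen S → Sen S′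
  sen₁ = Functor.F₁ sen

  ModCat : Signature → Category mo mℓ me
  ModCat = Functor.F₀ Mod

  Model : Signature → Set mo
  Model S = Category.Obj (ModCat S)

  reduct : ∀ {S S′} → SigMor S S′ → Model S′ → Model S
  reduct H = Functor.F₀ (Functor.F₁ Mod H)

  field
    _⊨_          : ∀ {S} → Model S → Sen S → Set r
    satisfaction : ∀ {S S′} (H : SigMor S S′) (M′ : Model S′) (φ : Sen S) →
                   (M′ ⊨ sen₁ H φ) ⇔ (reduct H M′ ⊨ φ)

module _ {o ℓ e s mo mℓ me r o′ ℓ′ e′ r′ : Level}
         (I  : Institution o  ℓ  e  s mo mℓ me r)
         (I′ : Institution o′ ℓ′ e′ s mo mℓ me r′) where
  private
    module I  = Institution I
    module I′ = Institution I′

  record IsInstitutionMorphism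
           (Φ : Functor I.Sign I′.Sign)
           (α : ∀ S → I′.Sen (Functor.F₀ Φ S) → I.Sen S)
           (β : ∀ S → Functor (I.ModCat S) (I′.ModCat (Functor.F₀ Φ S))) :
           Set (o ⊔ ℓ ⊔ s ⊔ mo ⊔ mℓ ⊔ me ⊔ r ⊔ r′) where
    field
      α-natural    : IsNatural (I′.sen ∘F Φ) I.sen α
      β-natural    : IsNatural I.Mod (I′.Mod ∘F opF Φ) β
      satisfaction : ∀ S (M : I.Model S) (φ : I′.Sen (Functor.F₀ Φ S)) →
                     (M I.⊨ α S φ) ⇔ (Functor.F₀ (β S) M I′.⊨ φ)

------------------------------------------------------------------------
-- The institution of covariant-contravariant systems

data Class : Set where
  covariant contravariant bivariant : Class

-- A triple (A , B , C) of pairwise disjoint sets, given as the union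
-- A ∪ B ∪ C together with the map recording which of the three sets an
-- action belongs to.
record SigCC : Set₁ where
  field
    Action : Set
    class  : Action → Class

  A B C : Pred Action 0ℓ
  A a = class a ≡ covariant
  B a = class a ≡ contravariant
  C a = class a ≡ bivariant

open SigCC using (Action; class)

record MorCC (S T : SigCC) : Set where
  private
    module S = SigCC S
    module T = SigCC T
  field
    fun : S.Action → T.Action
    fA⊆ : ∀ {a} → a ∈ S.A → fun a ∈ T.A
    fB⊆ : ∀ {a} → a ∈ S.B → fun a ∈ T.B
    fC⊆ : ∀ {a} → a ∈ S.C → fun a ∈ T.C

  fA∪C⊆ : ∀ {a} → a ∈ S.A ∪ S.C → fun a ∈ T.A ∪ T.C
  fA∪C⊆ = Sum.map fA⊆ fC⊆

  fB∪C⊆ : ∀ {a} → a ∈ S.B ∪ S.C → fun a ∈ T.B ∪ T.C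
  fB∪C⊆ = Sum.map fB⊆ fC⊆

-- Morphisms are compared as functions with _≡_ rather than _≗_, since equal
-- signature morphisms must induce strictly equal reduct functors.  The two
-- agree under function extensionality.
Sign-cc : Category (lsuc 0ℓ) 0ℓ 0ℓ
Sign-cc = record
  { Obj = SigCC ; Hom = MorCC ; _≈_ = λ f g → fun f ≡ fun g
  ; idn = record { fun = id ; fA⊆ = id ; fB⊆ = id ; fC⊆ = id }
  ; _∘_ = λ g f → record
    { fun = fun g ∘′ fun f
    ; fA⊆ = λ a∈ → fA⊆ g (fA⊆ f a∈)
    ; fB⊆ = λ a∈ → fB⊆ g (fB⊆ f a∈)
    ; fC⊆ = λ a∈ → fC⊆ g (fC⊆ f a∈)
    }
  ; equiv = record { refl = refl ; sym = sym ; trans = trans }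
  ; ∘-resp-≈ = cong₂ (λ g f → g ∘′ f)
  ; identityˡ = λ _ → refl
  ; identityʳ = λ _ → refl
  ; assoc = λ _ _ _ → refl
  }
  where open MorCC

module CC where
  infixr 7 _∧_
  infixr 6 _∨_
  infixr 8 [_∣_]_ ⟨_∣_⟩_

  -- The membership proofs are irrelevant, so that formulae differing only in
  -- them are equal.
  data Formula (S : SigCC) : Set where
    ff tt   : Formula S
    _∧_ _∨_ : Formula S → Formula S → Formula S
    [_∣_]_  : (b : Action S) → .(b ∈ SigCC.B S ∪ SigCC.C S) →
              Formula S → Formula S
    ⟨_∣_⟩_  : (a : Action S) → .(a ∈ SigCC.A S ∪ SigCC.C S) →
              Formula S → Formula S

  rename : ∀ {S T} → MorCC S T → Formula S → Formula T
  rename f ff             = ff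
  rename f tt             = tt
  rename f (φ ∧ ψ)        = rename f φ ∧ rename f ψ
  rename f (φ ∨ ψ)        = rename f φ ∨ rename f ψ
  rename f ([ b ∣ b∈ ] φ) = [ MorCC.fun f b ∣ MorCC.fB∪C⊆ f b∈ ] rename f φ
  rename f (⟨ a ∣ a∈ ⟩ φ) = ⟨ MorCC.fun f a ∣ MorCC.fA∪C⊆ f a∈ ⟩ rename f φ

  rename-resp : ∀ {S T} {f g : MorCC S T} → MorCC.fun f ≡ MorCC.fun g →
                rename f ≗ rename g
  rename-resp p ff             = refl
  rename-resp p tt             = refl
  rename-resp p (φ ∧ ψ)        = cong₂ _∧_ (rename-resp p φ) (rename-resp p ψ)
  rename-resp p (φ ∨ ψ)        = cong₂ _∨_ (rename-resp p φ) (rename-resp p ψ)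
  rename-resp {f = f@record { fun = k }} {record { fun = .k }} refl
    ([ b ∣ b∈ ] φ) = cong ([ k b ∣ MorCC.fB∪C⊆ f b∈ ]_) (rename-resp refl φ)
  rename-resp {f = f@record { fun = k }} {record { fun = .k }} refl
    (⟨ a ∣ a∈ ⟩ φ) = cong (⟨ k a ∣ MorCC.fA∪C⊆ f a∈ ⟩_) (rename-resp refl φ)

  rename-id : ∀ {S} → rename (Category.idn Sign-cc {S}) ≗ id
  rename-id ff             = refl
  rename-id tt             = refl
  rename-id (φ ∧ ψ)        = cong₂ _∧_ (rename-id φ) (rename-id ψ)
  rename-id (φ ∨ ψ)        = cong₂ _∨_ (rename-id φ) (rename-id ψ)
  rename-id ([ b ∣ b∈ ] φ) = cong ([ b ∣ b∈ ]_) (rename-id φ)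
  rename-id (⟨ a ∣ a∈ ⟩ φ) = cong (⟨ a ∣ a∈ ⟩_) (rename-id φ)

  rename-∘ : ∀ {S T U} (g : MorCC T U) (f : MorCC S T) →
             rename (Category._∘_ Sign-cc g f) ≗ rename g ∘′ rename f
  rename-∘ g f ff             = refl
  rename-∘ g f tt             = refl
  rename-∘ g f (φ ∧ ψ)        = cong₂ _∧_ (rename-∘ g f φ) (rename-∘ g f ψ)
  rename-∘ g f (φ ∨ ψ)        = cong₂ _∨_ (rename-∘ g f φ) (rename-∘ g f ψ)
  rename-∘ g f ([ b ∣ b∈ ] φ) =
    cong ([ _ ∣ MorCC.fB∪C⊆ g (MorCC.fB∪C⊆ f b∈) ]_) (rename-∘ g f φ)
  rename-∘ g f (⟨ a ∣ a∈ ⟩ φ) =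
    cong (⟨ _ ∣ MorCC.fA∪C⊆ g (MorCC.fA∪C⊆ f a∈) ⟩_) (rename-∘ g f φ)

sen-cc : Functor Sign-cc (Sets 0ℓ)
sen-cc = functor {F₀ = CC.Formula} {F₁ = CC.rename} (record
  { F-resp-≈ = λ {_} {_} {f} {g} → CC.rename-resp {f = f} {g}
  ; identity = CC.rename-id
  ; homomorphism = CC.rename-∘
  })

record LTS (Act : Set) : Set₁ where
  field
    State : Set
    Step  : State → Act → State → Set

record PointedLTS (Act : Set) : Set₁ where
  constructor _,_
  field
    lts   : LTS Act
    point : LTS.State lts
  open LTS lts public

record IsCCSimulation (S : SigCC) (P Q : LTS (Action S))
                      (R : REL (LTS.State P) (LTS.State Q) 0ℓ) : Set where
  private
    module S = SigCC S
    module P = LTS P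
    module Q = LTS Q
  field
    forth : ∀ {a p q p′} → a ∈ S.A ∪ S.C → R p q → P.Step p a p′ →
            ∃[ q′ ] Q.Step q a q′ × R p′ q′
    back  : ∀ {a p q q′} → a ∈ S.B ∪ S.C → R p q → Q.Step q a q′ →
            ∃[ p′ ] P.Step p a p′ × R p′ q′

record HomCC (S : SigCC) (P Q : PointedLTS (Action S)) : Set₁ where
  private
    module P = PointedLTS P
    module Q = PointedLTS Q
  field
    rel   : REL P.State Q.State 0ℓ
    isSim : IsCCSimulation S P.lts Q.lts rel
    point : rel P.point Q.point

Models-cc : SigCC → Category (lsuc 0ℓ) (lsuc 0ℓ) 0ℓ
Models-cc S = record
  { Obj = PointedLTS (Action S)
  ; Hom = HomCC S
  ; _≈_ = λ R T → (rel R ⇒ rel T) × (rel T ⇒ rel R)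
  ; idn = record
    { rel = _≡_
    ; isSim = record
      { forth = λ { _ refl st → _ , st , refl }
      ; back  = λ { _ refl st → _ , st , refl }
      }
    ; point = refl
    }
  ; _∘_ = λ T R → record
    { rel = rel R ; rel T
    ; isSim = record
      { forth = λ { a∈ (_ , r , t) st →
          let _ , st′ , r′ = forth (isSim R) a∈ r st
              _ , st″ , t′ = forth (isSim T) a∈ t st′
          in _ , st″ , _ , r′ , t′ }
      ; back = λ { a∈ (_ , r , t) st →
          let _ , st′ , t′ = back (isSim T) a∈ t st
              _ , st″ , r′ = back (isSim R) a∈ r st′
          in _ , st″ , _ , r′ , t′ }
      }
    ; point = _ , point R , point T
    }
  ; equiv = record
    { refl = id , id
    ; sym = λ { (p , q) → q , p }
    ; trans = λ { (p , q) (p′ , q′) → (λ x → p′ (p x)) , (λ x → q (q′ x)) }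
    }
  ; ∘-resp-≈ = λ { (p , p′) (q , q′) →
      (λ { (_ , r , t) → _ , q r , p t }) ,
      (λ { (_ , r , t) → _ , q′ r , p′ t }) }
  ; identityˡ = λ _ → (λ { (_ , r , refl) → r }) , (λ r → _ , r , refl)
  ; identityʳ = λ _ → (λ { (_ , refl , r) → r }) , (λ r → _ , refl , r)
  ; assoc = λ _ _ _ →
      (λ { (_ , r , _ , s , t) → _ , (_ , r , s) , t }) ,
      (λ { (_ , (_ , r , s) , t) → _ , r , _ , s , t })
  }
  where
  open HomCC
  open IsCCSimulation

reductLTS : ∀ {X Y} → (X → Y) → PointedLTS Y → PointedLTS X
reductLTS f (P , p) =
  record { State = LTS.State P ; Step = λ s a s′ → LTS.Step P s (f a) s′ } , p

reduct-cc : ∀ {S T} → MorCC S T → Functor (Models-cc T) (Models-cc S)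
reduct-cc f = functor
  {F₀ = reductLTS fun}
  {F₁ = λ R → record
    { rel = rel R
    ; isSim = record
      { forth = λ a∈ → forth (isSim R) (fA∪C⊆ a∈)
      ; back  = λ a∈ → back (isSim R) (fB∪C⊆ a∈)
      }
    ; point = point R
    }}
  (record
    { F-resp-≈ = id
    ; identity = id , id
    ; homomorphism = λ _ _ → id , id
    })
  where
  open MorCC f
  open HomCC
  open IsCCSimulation

reduct-cc-resp : ∀ {S T} {f g : MorCC S T} → MorCC.fun f ≡ MorCC.fun g →
                 reduct-cc f ≡F reduct-cc g
reduct-cc-resp {f = record { fun = k }} {record { fun = .k }} refl =
  record { eq₀ = λ _ → refl ; eq₁ = λ _ → id , id }

Mod-cc : Functor (op Sign-cc) (Cat (lsuc 0ℓ) (lsuc 0ℓ) 0ℓ)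
Mod-cc = functor {F₀ = Models-cc} {F₁ = reduct-cc} (record
  { F-resp-≈ = λ {_} {_} {f} {g} → reduct-cc-resp {f = f} {g}
  ; identity = record { eq₀ = λ _ → refl ; eq₁ = λ _ → id , id }
  ; homomorphism = λ _ _ →
      record { eq₀ = λ _ → refl ; eq₁ = λ _ → id , id }
  })

module _ {S : SigCC} (P : LTS (Action S)) where
  open LTS P
  open CC

  Sat-cc : State → Formula S → Set
  Sat-cc s ff            = ⊥
  Sat-cc s tt            = ⊤
  Sat-cc s (φ ∧ ψ)       = Sat-cc s φ × Sat-cc s ψ
  Sat-cc s (φ ∨ ψ)       = Sat-cc s φ ⊎ Sat-cc s ψ
  Sat-cc s ([ b ∣ _ ] φ) = ∀ s′ → Step s b s′ → Sat-cc s′ φ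
  Sat-cc s (⟨ a ∣ _ ⟩ φ) = ∃[ s′ ] Step s a s′ × Sat-cc s′ φ

_⊨cc_ : ∀ {S} → PointedLTS (Action S) → CC.Formula S → Set
(P , s) ⊨cc φ = Sat-cc P s φ

module _ {S T : SigCC} (f : MorCC S T) (P : LTS (Action T)) where
  open LTS P
  open CC
  open Equivalence

  satisfaction-cc : ∀ s φ → ((P , s) ⊨cc rename f φ) ⇔
                            (reductLTS (MorCC.fun f) (P , s) ⊨cc φ)
  satisfaction-cc s ff = mk⇔ id id
  satisfaction-cc s tt = mk⇔ id id
  satisfaction-cc s (φ ∧ ψ) = mk⇔
    (Product.map (to (satisfaction-cc s φ)) (to (satisfaction-cc s ψ)))
    (Product.map (from (satisfaction-cc s φ)) (from (satisfaction-cc s ψ)))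
  satisfaction-cc s (φ ∨ ψ) = mk⇔
    (Sum.map (to (satisfaction-cc s φ)) (to (satisfaction-cc s ψ)))
    (Sum.map (from (satisfaction-cc s φ)) (from (satisfaction-cc s ψ)))
  satisfaction-cc s ([ b ∣ _ ] φ) = mk⇔
    (λ h s′ st → to (satisfaction-cc s′ φ) (h s′ st))
    (λ h s′ st → from (satisfaction-cc s′ φ) (h s′ st))
  satisfaction-cc s (⟨ a ∣ _ ⟩ φ) = mk⇔
    (map₂ λ {s′} → map₂ (to (satisfaction-cc s′ φ)))
    (map₂ λ {s′} → map₂ (from (satisfaction-cc s′ φ)))

I-cc : Institution (lsuc 0ℓ) 0ℓ 0ℓ 0ℓ (lsuc 0ℓ) (lsuc 0ℓ) 0ℓ 0ℓ
I-cc = record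
  { Sign = Sign-cc ; sen = sen-cc ; Mod = Mod-cc
  ; _⊨_ = _⊨cc_
  ; satisfaction = λ { f (P , s) φ → satisfaction-cc f P s φ }
  }

------------------------------------------------------------------------
-- The institution of modal transition systems

-- The category of sets; on the use of _≡_, see Sign-cc.
Sign-mts : Category (lsuc 0ℓ) 0ℓ 0ℓ
Sign-mts = record
  { Obj = Set ; Hom = λ X Y → X → Y ; _≈_ = _≡_
  ; idn = id ; _∘_ = _∘′_
  ; equiv = isEquivalence
  ; ∘-resp-≈ = cong₂ (λ g f → g ∘′ f)
  ; identityˡ = λ _ → refl
  ; identityʳ = λ _ → refl
  ; assoc = λ _ _ _ → refl
  }

module MTSLogic where
  infixr 7 _∧_
  infixr 6 _∨_
  infixr 8 [_]_ ⟨_⟩_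

  data Formula (A : Set) : Set where
    ff tt     : Formula A
    _∧_ _∨_   : Formula A → Formula A → Formula A
    [_]_ ⟨_⟩_ : A → Formula A → Formula A

  rename : ∀ {A B} → (A → B) → Formula A → Formula B
  rename f ff        = ff
  rename f tt        = tt
  rename f (φ ∧ ψ)   = rename f φ ∧ rename f ψ
  rename f (φ ∨ ψ)   = rename f φ ∨ rename f ψ
  rename f ([ a ] φ) = [ f a ] rename f φ
  rename f (⟨ a ⟩ φ) = ⟨ f a ⟩ rename f φ

  rename-id : ∀ {A} → rename (id {A = A}) ≗ id
  rename-id ff        = refl
  rename-id tt        = refl
  rename-id (φ ∧ ψ)   = cong₂ _∧_ (rename-id φ) (rename-id ψ)
  rename-id (φ ∨ ψ)   = cong₂ _∨_ (rename-id φ) (rename-id ψ)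
  rename-id ([ a ] φ) = cong [ a ]_ (rename-id φ)
  rename-id (⟨ a ⟩ φ) = cong ⟨ a ⟩_ (rename-id φ)

  rename-∘ : ∀ {A B C} (g : B → C) (f : A → B) →
             rename (g ∘′ f) ≗ rename g ∘′ rename f
  rename-∘ g f ff        = refl
  rename-∘ g f tt        = refl
  rename-∘ g f (φ ∧ ψ)   = cong₂ _∧_ (rename-∘ g f φ) (rename-∘ g f ψ)
  rename-∘ g f (φ ∨ ψ)   = cong₂ _∨_ (rename-∘ g f φ) (rename-∘ g f ψ)
  rename-∘ g f ([ a ] φ) = cong [ g (f a) ]_ (rename-∘ g f φ)
  rename-∘ g f (⟨ a ⟩ φ) = cong ⟨ g (f a) ⟩_ (rename-∘ g f φ)

sen-mts : Functor Sign-mts (Sets 0ℓ)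
sen-mts = functor {F₀ = MTSLogic.Formula} {F₁ = MTSLogic.rename} (record
  { F-resp-≈ = λ { refl _ → refl }
  ; identity = MTSLogic.rename-id
  ; homomorphism = MTSLogic.rename-∘
  })

data Modality : Set where
  □ ◇ : Modality

-- The relations →□ and →◇ are Step □ and Step ◇.
record MTS (A : Set) : Set₁ where
  field
    State : Set
    Step  : Modality → State → A → State → Set
    □⊆◇   : ∀ {p a p′} → Step □ p a p′ → Step ◇ p a p′

record PointedMTS (A : Set) : Set₁ where
  constructor _,_
  field
    mts   : MTS A
    point : MTS.State mts
  open MTS mts public

record IsRefinement {A : Set} (M N : MTS A)
                    (R : REL (MTS.State M) (MTS.State N) 0ℓ) : Set where
  private
    module M = MTS M
    module N = MTS N
  field
    must : ∀ {a p q p′} → R p q → M.Step □ p a p′ →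
           ∃[ q′ ] N.Step □ q a q′ × R p′ q′
    may  : ∀ {a p q q′} → R p q → N.Step ◇ q a q′ →
           ∃[ p′ ] M.Step ◇ p a p′ × R p′ q′

record HomMTS {A : Set} (M N : PointedMTS A) : Set₁ where
  private
    module M = PointedMTS M
    module N = PointedMTS N
  field
    rel          : REL M.State N.State 0ℓ
    isRefinement : IsRefinement M.mts N.mts rel
    point        : rel M.point N.point

Models-mts : Set → Category (lsuc 0ℓ) (lsuc 0ℓ) 0ℓ
Models-mts A = record
  { Obj = PointedMTS A
  ; Hom = HomMTS
  ; _≈_ = λ R T → (rel R ⇒ rel T) × (rel T ⇒ rel R)
  ; idn = record
    { rel = _≡_
    ; isRefinement = record
      { must = λ { refl st → _ , st , refl }
      ; may  = λ { refl st → _ , st , refl }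
      }
    ; point = refl
    }
  ; _∘_ = λ T R → record
    { rel = rel R ; rel T
    ; isRefinement = record
      { must = λ { (_ , r , t) st →
          let _ , st′ , r′ = must (isRefinement R) r st
              _ , st″ , t′ = must (isRefinement T) t st′
          in _ , st″ , _ , r′ , t′ }
      ; may = λ { (_ , r , t) st →
          let _ , st′ , t′ = may (isRefinement T) t st
              _ , st″ , r′ = may (isRefinement R) r st′
          in _ , st″ , _ , r′ , t′ }
      }
    ; point = _ , point R , point T
    }
  ; equiv = record
    { refl = id , id
    ; sym = λ { (p , q) → q , p }
    ; trans = λ { (p , q) (p′ , q′) → (λ x → p′ (p x)) , (λ x → q (q′ x)) }
    }
  ; ∘-resp-≈ = λ { (p , p′) (q , q′) →
      (λ { (_ , r , t) → _ , q r , p t }) ,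
      (λ { (_ , r , t) → _ , q′ r , p′ t }) }
  ; identityˡ = λ _ → (λ { (_ , r , refl) → r }) , (λ r → _ , r , refl)
  ; identityʳ = λ _ → (λ { (_ , refl , r) → r }) , (λ r → _ , refl , r)
  ; assoc = λ _ _ _ →
      (λ { (_ , r , _ , s , t) → _ , (_ , r , s) , t }) ,
      (λ { (_ , (_ , r , s) , t) → _ , r , _ , s , t })
  }
  where
  open HomMTS
  open IsRefinement

reductMTS : ∀ {A B} → (A → B) → PointedMTS B → PointedMTS A
reductMTS f (M , m) = record
  { State = MTS.State M
  ; Step  = λ k p a p′ → MTS.Step M k p (f a) p′
  ; □⊆◇   = MTS.□⊆◇ M
  } , m

reduct-mts : ∀ {A B} → (A → B) → Functor (Models-mts B) (Models-mts A)
reduct-mts f = functor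
  {F₀ = reductMTS f}
  {F₁ = λ R → record
    { rel = rel R
    ; isRefinement = record
      { must = must (isRefinement R)
      ; may  = may (isRefinement R)
      }
    ; point = point R
    }}
  (record
    { F-resp-≈ = id
    ; identity = id , id
    ; homomorphism = λ _ _ → id , id
    })
  where
  open HomMTS
  open IsRefinement

Mod-mts : Functor (op Sign-mts) (Cat (lsuc 0ℓ) (lsuc 0ℓ) 0ℓ)
Mod-mts = functor {F₀ = Models-mts} {F₁ = reduct-mts} (record
  { F-resp-≈ = λ { refl → record { eq₀ = λ _ → refl ; eq₁ = λ _ → id , id } }
  ; identity = record { eq₀ = λ _ → refl ; eq₁ = λ _ → id , id }
  ; homomorphism = λ _ _ →
      record { eq₀ = λ _ → refl ; eq₁ = λ _ → id , id }
  })

module _ {A : Set} (M : MTS A) where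
  open MTS M
  open MTSLogic

  Sat-mts : State → Formula A → Set
  Sat-mts s ff        = ⊥
  Sat-mts s tt        = ⊤
  Sat-mts s (φ ∧ ψ)   = Sat-mts s φ × Sat-mts s ψ
  Sat-mts s (φ ∨ ψ)   = Sat-mts s φ ⊎ Sat-mts s ψ
  Sat-mts s ([ a ] φ) = ∀ s′ → Step ◇ s a s′ → Sat-mts s′ φ
  Sat-mts s (⟨ a ⟩ φ) = ∃[ s′ ] Step □ s a s′ × Sat-mts s′ φ

_⊨mts_ : ∀ {A} → PointedMTS A → MTSLogic.Formula A → Set
(M , s) ⊨mts φ = Sat-mts M s φ

module _ {A B : Set} (f : A → B) (M : MTS B) where
  open MTSLogic
  open Equivalence

  satisfaction-mts : ∀ s φ → ((M , s) ⊨mts rename f φ) ⇔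
                             (reductMTS f (M , s) ⊨mts φ)
  satisfaction-mts s ff = mk⇔ id id
  satisfaction-mts s tt = mk⇔ id id
  satisfaction-mts s (φ ∧ ψ) = mk⇔
    (Product.map (to (satisfaction-mts s φ)) (to (satisfaction-mts s ψ)))
    (Product.map (from (satisfaction-mts s φ)) (from (satisfaction-mts s ψ)))
  satisfaction-mts s (φ ∨ ψ) = mk⇔
    (Sum.map (to (satisfaction-mts s φ)) (to (satisfaction-mts s ψ)))
    (Sum.map (from (satisfaction-mts s φ)) (from (satisfaction-mts s ψ)))
  satisfaction-mts s ([ a ] φ) = mk⇔
    (λ h s′ st → to (satisfaction-mts s′ φ) (h s′ st))
    (λ h s′ st → from (satisfaction-mts s′ φ) (h s′ st))
  satisfaction-mts s (⟨ a ⟩ φ) = mk⇔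
    (map₂ λ {s′} → map₂ (to (satisfaction-mts s′ φ)))
    (map₂ λ {s′} → map₂ (from (satisfaction-mts s′ φ)))

I-mts : Institution (lsuc 0ℓ) 0ℓ 0ℓ 0ℓ (lsuc 0ℓ) (lsuc 0ℓ) 0ℓ 0ℓ
I-mts = record
  { Sign = Sign-mts ; sen = sen-mts ; Mod = Mod-mts
  ; _⊨_ = _⊨mts_
  ; satisfaction = λ { f (M , s) φ → satisfaction-mts f M s φ }
  }

------------------------------------------------------------------------
-- The data of the morphism from I-mts to I-cc

-- cv(A) ∪ ct(A).  Tagging by modality, with functions acting on the untagged
-- part, lets Φ preserve identities, and commute with reducts, strictly and
-- without function extensionality.
pattern cv a = □ , a
pattern ct a = ◇ , a

classOf : Modality → Class
classOf □ = covariant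
classOf ◇ = contravariant

Φ₀ : Set → SigCC
Φ₀ A = record { Action = Modality × A ; class = λ x → classOf (proj₁ x) }

Φ₁ : ∀ {A B} → (A → B) → MorCC (Φ₀ A) (Φ₀ B)
Φ₁ f = record
  { fun = λ x → proj₁ x , f (proj₂ x)
  ; fA⊆ = id ; fB⊆ = id ; fC⊆ = id
  }

module _ {A : Set} where
  open SigCC (Φ₀ A) using () renaming (A to cov; B to con; C to biv)

  ct∉A∪C : ∀ a → ¬ (ct a ∈ cov ∪ biv)
  ct∉A∪C _ (inj₁ ())
  ct∉A∪C _ (inj₂ ())

  cv∉B∪C : ∀ a → ¬ (cv a ∈ con ∪ biv)
  cv∉B∪C _ (inj₁ ())
  cv∉B∪C _ (inj₂ ())

α : ∀ A → CC.Formula (Φ₀ A) → MTSLogic.Formula A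
α A CC.ff                  = MTSLogic.ff
α A CC.tt                  = MTSLogic.tt
α A (φ CC.∧ ψ)             = α A φ MTSLogic.∧ α A ψ
α A (φ CC.∨ ψ)             = α A φ MTSLogic.∨ α A ψ
α A (CC.⟨ cv a ∣ _ ⟩ φ)    = MTSLogic.⟨ a ⟩ α A φ
α A (CC.⟨ ct a ∣ ct∈ ⟩ φ)  = ⊥-elim-irr (ct∉A∪C a ct∈)
α A (CC.[ ct a ∣ _ ] φ)    = MTSLogic.[ a ] α A φ
α A (CC.[ cv a ∣ cv∈ ] φ)  = ⊥-elim-irr (cv∉B∪C a cv∈)

-- The ct-steps are the ◇-steps and the cv-steps are the □-steps.
𝒞 : ∀ {A} → MTS A → LTS (Action (Φ₀ A))
𝒞 M = record
  { State = MTS.State M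
  ; Step  = λ p x p′ → MTS.Step M (proj₁ x) p (proj₂ x) p′
  }

β₀ : ∀ A → PointedMTS A → PointedLTS (Action (Φ₀ A))
β₀ A (M , s) = 𝒞 M , s

-- β sends R to itself, which presupposes that refinements are
-- covariant-contravariant simulations.
β₁ : ∀ A →
     (∀ {M N : MTS A} {R} →
        IsRefinement M N R → IsCCSimulation (Φ₀ A) (𝒞 M) (𝒞 N) R) →
     ∀ {M N : PointedMTS A} →
     HomMTS M N → HomCC (Φ₀ A) (β₀ A M) (β₀ A N)
β₁ A sim R = record
  { rel   = HomMTS.rel R
  ; isSim = sim (HomMTS.isRefinement R)
  ; point = HomMTS.point R
  }

{-# OPTIONS --safe #-}
module Submission where

open import Defs
open import Data.Empty using (⊥-elim; ⊥-elim-irr)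
open import Data.Product using (Σ-syntax; _,_; map₂)
import Data.Product as Product
import Data.Sum as Sum
open import Function.Base using (id)
open import Function.Bundles using (_⇔_; mk⇔; Equivalence)
open import Relation.Binary.PropositionalEquality
  using (_≡_; refl; cong; cong₂)

-- `𝒞` only moves the modality of a step into its label, so nothing about an MTS is lost. Covariant
-- clauses speak of □-steps and contravariant ones of ◇-steps: `refinement⇒simulation` matches
-- `must` and `may` with `forth` and `back`, and `α-satisfaction` matches the modal operators by
-- induction on formulae. As `Φ₁ f` leaves tags alone, it commutes with both translations.

Φ-isFunctor : IsFunctor Sign-mts Sign-cc Φ₀ Φ₁
Φ-isFunctor = record
  { F-resp-≈     = cong λ f → MorCC.fun (Φ₁ f)
  -- Holds by eta for pairs: retagging with the same tag is the identity.
  ; identity     = refl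
  ; homomorphism = λ _ _ → refl
  }

refinement⇒simulation : ∀ A {M N : MTS A} {R} → IsRefinement M N R →
                        IsCCSimulation (Φ₀ A) (𝒞 M) (𝒞 N) R
refinement⇒simulation A ref = record
  -- With no bivariant actions, each clause has one tag to treat; the other is excluded by its
  -- membership proof.
  { forth = λ { {cv a} _ → must ; {ct a} ct∈ → ⊥-elim (ct∉A∪C a ct∈) }
  ; back  = λ { {ct a} _ → may  ; {cv a} cv∈ → ⊥-elim (cv∉B∪C a cv∈) }
  }
  where open IsRefinement ref

β-isFunctor : ∀ A → IsFunctor (Models-mts A) (Models-cc (Φ₀ A))
                      (β₀ A) (β₁ A (refinement⇒simulation A))
β-isFunctor A = record
  { F-resp-≈     = id
  ; identity     = id , id
  ; homomorphism = λ _ _ → id , id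
  }

-- Renaming keeps tags, so both sides fall under the same clause of `α`.
α-rename : ∀ {A B} (f : A → B) φ →
           α B (CC.rename (Φ₁ f) φ) ≡ MTSLogic.rename f (α A φ)
α-rename f CC.ff                 = refl
α-rename f CC.tt                 = refl
α-rename f (φ CC.∧ ψ)            = cong₂ MTSLogic._∧_ (α-rename f φ) (α-rename f ψ)
α-rename f (φ CC.∨ ψ)            = cong₂ MTSLogic._∨_ (α-rename f φ) (α-rename f ψ)
α-rename f (CC.[ ct a ∣ _ ] φ)   = cong MTSLogic.[ f a ]_ (α-rename f φ)
-- No such formula exists; its membership proof is irrelevant, hence the irrelevant eliminator.
α-rename f (CC.[ cv a ∣ cv∈ ] φ) = ⊥-elim-irr (cv∉B∪C a cv∈)
α-rename f (CC.⟨ cv a ∣ _ ⟩ φ)   = cong MTSLogic.⟨ f a ⟩_ (α-rename f φ)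
α-rename f (CC.⟨ ct a ∣ ct∈ ⟩ φ) = ⊥-elim-irr (ct∉A∪C a ct∈)

module _ {A} (M : MTS A) where
  open Equivalence

  α-satisfaction : ∀ s φ → Sat-mts M s (α A φ) ⇔ Sat-cc (𝒞 M) s φ
  α-satisfaction s CC.ff = mk⇔ id id
  α-satisfaction s CC.tt = mk⇔ id id
  α-satisfaction s (φ CC.∧ ψ) = mk⇔
    (Product.map (to (α-satisfaction s φ)) (to (α-satisfaction s ψ)))
    (Product.map (from (α-satisfaction s φ)) (from (α-satisfaction s ψ)))
  α-satisfaction s (φ CC.∨ ψ) = mk⇔
    (Sum.map (to (α-satisfaction s φ)) (to (α-satisfaction s ψ)))
    (Sum.map (from (α-satisfaction s φ)) (from (α-satisfaction s ψ)))
  α-satisfaction s (CC.[ ct a ∣ _ ] φ) = mk⇔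
    -- A `ct a` step of `𝒞 M` is by definition a ◇-step of `M`, so `st` serves on both sides.
    (λ h s′ st → to (α-satisfaction s′ φ) (h s′ st))
    (λ h s′ st → from (α-satisfaction s′ φ) (h s′ st))
  α-satisfaction s (CC.[ cv a ∣ cv∈ ] φ) = ⊥-elim-irr (cv∉B∪C a cv∈)
  α-satisfaction s (CC.⟨ cv a ∣ _ ⟩ φ) = mk⇔
    (map₂ λ {s′} → map₂ (to (α-satisfaction s′ φ)))
    (map₂ λ {s′} → map₂ (from (α-satisfaction s′ φ)))
  α-satisfaction s (CC.⟨ ct a ∣ ct∈ ⟩ φ) = ⊥-elim-irr (ct∉A∪C a ct∈)

proposition23 : Σ[ Φ-isFunctor ∈ IsFunctor Sign-mts Sign-cc Φ₀ Φ₁ ]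
    Σ[ sim ∈ (∀ A {M N : MTS A} {R} → IsRefinement M N R →
    IsCCSimulation (Φ₀ A) (𝒞 M) (𝒞 N) R) ]
    Σ[ β-isFunctor ∈ (∀ A → IsFunctor (Models-mts A) (Models-cc (Φ₀ A))
    (β₀ A) (β₁ A (sim A))) ]
    IsInstitutionMorphism I-mts I-cc
    (functor Φ-isFunctor) α (λ A → functor (β-isFunctor A))
proposition23 =
  Φ-isFunctor , refinement⇒simulation , β-isFunctor , record
  { α-natural    = α-rename
  -- Both composites give an LTS whose steps at `x` are those of `M` with modality `proj₁ x` and
  -- action `f (proj₂ x)`; relations are untouched.
  ; β-natural    = λ _ → record { eq₀ = λ _ → refl ; eq₁ = λ _ → id , id }
  ; satisfaction = λ { _ (M , s) φ → α-satisfaction M s φ }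
  }
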